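{- Let $X$ be a finite set. The monoid $(\mathcal{M}(X), \triangleright)$ is isomorphic to the submonoid of $\mathcal{T}_{X\times X}$ consisting of all transformations $T : X\times X\to X\times X$ that commute with $^\leftarrow$, i.e. such that $T((a,b)^\leftarrow) = (T(a,b))^\leftarrow$ for all $a,b\in X$.
   Context: $\mathcal{M}(X)=X^{X\times X}$ is the set of all binary operations on $X$. The operation $\triangleright$ on $\mathcal{M}(X)$ is defined by $a(\circ\triangleright\ast)b=(a\circ b)\ast(b\circ a)$ for all $\circ,\ast\in\mathcal{M}(X)$ and $a,b\in X$; $(\mathcal{M}(X),\triangleright)$ is a monoid whose identity is the left zeros operation $a\circ_{lz}b=a$. $\mathcal{T}_{X\times X}$ is the monoid of all maps $X\times X\to X\times X$, with product given by composition from left to right: the product $ST$ is the map $p\mapsto T(S(p))$. For $u,v\in X$, $(u,v)^\leftarrow=(v,u)$. -}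

module Defs where

open import Algebra.Bundles using (Monoid)
open import Algebra.Core using (Op₂)
open import Algebra.Morphism.Structures using (module MonoidMorphisms)
open import Data.Fin.Base using (Fin)
open import Data.Nat.Base using (ℕ)
open import Data.Product.Base using (Σ; Σ-syntax; ∃; _×_; _,_; proj₁; swap)
open import Function.Base using (id; _∘_)
open import Function.Bundles using (_↔_)
open import Level using (Level; _⊔_)
open import Relation.Binary.PropositionalEquality
  using (_≡_; refl; sym; trans; cong; cong₂)
open import Relation.Unary using (Pred)

private
  variable
    a b c p ℓ ℓ₁ ℓ₂ : Level

Finite : Set a → Set a
Finite X = Σ[ n ∈ ℕ ] (X ↔ Fin n)

-- Without function extensionality, equality of functions (binary operations,
-- transformations) is pointwise equality; it serves as the setoid equality
-- of the monoids below.

_▷_ : {X : Set a} → Op₂ X → Op₂ X → Op₂ X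
(_·_ ▷ _∗_) x y = (x · y) ∗ (y · x)

leftZeros : {X : Set a} → Op₂ X
leftZeros x y = x

𝓜 : Set a → Monoid a a
𝓜 X = record
  { Carrier  = Op₂ X
  ; _≈_      = λ f g → ∀ x y → f x y ≡ g x y
  ; _∙_      = _▷_
  ; ε        = leftZeros
  ; isMonoid = record
    { isSemigroup = record
      { isMagma = record
        { isEquivalence = record
          { refl  = λ _ _ → refl
          ; sym   = λ f≈g x y → sym (f≈g x y)
          ; trans = λ f≈g g≈h x y → trans (f≈g x y) (g≈h x y)
          }
        ; ∙-cong = λ {_} {_} {g} f≈f′ g≈g′ x y →
            trans (cong₂ g (f≈f′ x y) (f≈f′ y x)) (g≈g′ _ _)
        }
      ; assoc = λ _ _ _ _ _ → refl
      }
    ; identity = (λ _ _ _ → refl) , (λ _ _ _ → refl)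
    }
  }

-- Transformations are composed from left to right: the product of S and T
-- is p ↦ T (S p).

𝓣 : Set a → Monoid a a
𝓣 Y = record
  { Carrier  = Y → Y
  ; _≈_      = λ S T → ∀ p → S p ≡ T p
  ; _∙_      = λ S T → T ∘ S
  ; ε        = id
  ; isMonoid = record
    { isSemigroup = record
      { isMagma = record
        { isEquivalence = record
          { refl  = λ _ → refl
          ; sym   = λ S≈T q → sym (S≈T q)
          ; trans = λ S≈T T≈U q → trans (S≈T q) (T≈U q)
          }
        ; ∙-cong = λ {_} {_} {T} S≈S′ T≈T′ q →
            trans (cong T (S≈S′ q)) (T≈T′ _)
        }
      ; assoc = λ _ _ _ _ → refl
      }
    ; identity = (λ _ _ → refl) , (λ _ _ → refl)
    }
  }

infix 9 _←

_← : {X : Set a} → X × X → X × X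
_← = swap

Commutes← : {X : Set a} → Pred (X × X → X × X) a
Commutes← T = ∀ x y → T ((x , y) ←) ≡ (T (x , y)) ←

record IsSubmonoid (M : Monoid c ℓ) (P : Pred (Monoid.Carrier M) p)
                   : Set (c ⊔ ℓ ⊔ p) where
  open Monoid M
  field
    resp     : ∀ {x y} → x ≈ y → P x → P y
    ∙-closed : ∀ {x y} → P x → P y → P (x ∙ y)
    ε-closed : P ε

-- Elements are compared in M only; the membership proofs are irrelevant.

submonoid : (M : Monoid c ℓ) (P : Pred (Monoid.Carrier M) p) →
            IsSubmonoid M P → Monoid (c ⊔ p) ℓ
submonoid M P sub = record
  { Carrier  = Σ M.Carrier P
  ; _≈_      = λ u v → proj₁ u M.≈ proj₁ v
  ; _∙_      = λ { (x , Px) (y , Py) → (x M.∙ y) , ∙-closed Px Py }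
  ; ε        = M.ε , ε-closed
  ; isMonoid = record
    { isSemigroup = record
      { isMagma = record
        { isEquivalence = record
          { refl = M.refl ; sym = M.sym ; trans = M.trans }
        ; ∙-cong = M.∙-cong
        }
      ; assoc = λ _ _ _ → M.assoc _ _ _
      }
    ; identity = (λ _ → M.identityˡ _) , (λ _ → M.identityʳ _)
    }
  }
  where
  module M = Monoid M
  open IsSubmonoid sub

infix 4 _≅_

_≅_ : Monoid a ℓ₁ → Monoid b ℓ₂ → Set (a ⊔ b ⊔ ℓ₁ ⊔ ℓ₂)
M ≅ N = ∃ λ (f : Monoid.Carrier M → Monoid.Carrier N) → IsMonoidIsomorphism f
  where open MonoidMorphisms (Monoid.rawMonoid M) (Monoid.rawMonoid N)

{-# OPTIONS --safe #-}
module Submission where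

open import Algebra.Core using (Op₂)
open import Data.Product.Base using (Σ-syntax; _×_; _,_; proj₁; swap)
open import Level using (Level)
open import Relation.Binary.PropositionalEquality
  using (_≡_; refl; sym; trans; cong; cong₂)
open import Defs

-- A transformation T commuting with ← is determined by its first component:
-- if T (x , y) has first component x · y, then T (y , x) = (T (x , y)) ←
-- forces T (x , y) = (x · y , y · x).  Hence · ↦ T is a bijection, and
-- composing two such transformations from left to right yields ▷.

private
  variable
    a : Level
    X : Set a

transformation : Op₂ X → X × X → X × X
transformation _·_ (x , y) = x · y , y · x

transformation-commutes← : (_·_ : Op₂ X) → Commutes← (transformation _·_)
transformation-commutes← _·_ x y = refl

transformation-cong : {_·_ _∗_ : Op₂ X} → (∀ x y → x · y ≡ x ∗ y) →
                      ∀ p → transformation _·_ p ≡ transformation _∗_ p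
transformation-cong ·≈∗ (x , y) = cong₂ _,_ (·≈∗ x y) (·≈∗ y x)

operation : (X × X → X × X) → Op₂ X
operation T x y = proj₁ (T (x , y))

-- First components agree by definition. For the second, commuting with `←` makes the first
-- component of `T (y , x)` the second component of `T (x , y)`.
transformation∘operation : {T : X × X → X × X} → Commutes← T →
                           ∀ p → transformation (operation T) p ≡ T p
transformation∘operation {T = T} T-commutes (x , y) =
  cong (operation T x y ,_) (cong proj₁ (T-commutes x y))

commutes←-isSubmonoid : (X : Set a) → IsSubmonoid (𝓣 (X × X)) Commutes←
commutes←-isSubmonoid X = record
  { resp     = λ S≈T S-commutes x y →
      trans (sym (S≈T _)) (trans (S-commutes x y) (cong swap (S≈T _)))
  ; ∙-closed = λ {_} {T} S-commutes T-commutes x y →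
      -- The swap is moved through the inner map first; `T-commutes` is then used at the two
      -- components of that map's value at `(x , y)`.
      trans (cong T (S-commutes x y)) (T-commutes _ _)
  ; ε-closed = λ _ _ → refl
  }

𝓜≅commutes← : (X : Set a) →
  𝓜 X ≅ submonoid (𝓣 (X × X)) Commutes← (commutes←-isSubmonoid X)
𝓜≅commutes← X = embedding , record
  { isMonoidMonomorphism = record
    { isMonoidHomomorphism = record
      { isMagmaHomomorphism = record
        { isRelHomomorphism = record { cong = transformation-cong }
        -- For operations `·` and `∗`, both sides send `(x , y)` to
        -- `((x · y) ∗ (y · x) , (y · x) ∗ (x · y))`.
        ; homo = λ _ _ _ → refl
        }
      ; ε-homo = λ _ → refl
      }
    ; injective = λ S≈T x y → cong proj₁ (S≈T (x , y))
    }
  -- Every operation pointwise equal to the preimage `operation T` must be sent to `T`, hence the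
  -- initial `transformation-cong`.
  ; surjective = λ (T , T-commutes) → operation T , λ ·≈T p →
      trans (transformation-cong ·≈T p) (transformation∘operation T-commutes p)
  }
  where
  embedding : Op₂ X → Σ[ T ∈ (X × X → X × X) ] Commutes← T
  embedding _·_ = transformation _·_ , transformation-commutes← _·_

theorem3 : ∀ {a} (X : Set a) → Finite X →
    Σ[ sub ∈ IsSubmonoid (𝓣 (X × X)) Commutes← ]
    (𝓜 X ≅ submonoid (𝓣 (X × X)) Commutes← sub)
theorem3 X _ = commutes←-isSubmonoid X , 𝓜≅commutes← X
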